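{- For a lattice path $\nu$, let $P_\nu$ be the poset of $\nu$-Schröder trees (equivalently, up to isomorphism, the contraction poset of $\nu$-Schröder paths), and let $\widehat{P}_\nu$ denote $P_\nu$ with an adjoined minimal element $\hat 0$ and an adjoined maximal element $\hat 1$. If $\nu=(NE)^{n+1}$, then $P_\nu\cup\{\hat 0\}$ is isomorphic to the face lattice of the $n$-associahedron. For general $\nu$, $\widehat{P}_\nu$ is isomorphic to a sublattice of the face lattice of the $m$-associahedron, where $m$ is the number of steps in $\nu$.
   Context: The $n$-associahedron is the $n$-dimensional simple polytope whose poset of non-empty faces is isomorphic to the poset of diagonal dissections of a convex $(n+3)$-gon ordered by coarsening (minimal elements are the triangulations, the maximal element is the empty dissection); its face lattice is this poset together with a minimal element (the empty face). A lattice path from $(0,0)$ to $(b,a)\in\mathbb{Z}_{\ge0}^2$ is a sequence of $a$ north steps $N=(0,1)$ and $b$ east steps $E=(1,0)$. $R_\nu$ is the region weakly above $\nu$ inside the rectangle with corners $(0,0)$ and $(b,a)$. Two lattice points $p,q$ in $R_\nu$ are $\nu$-incompatible if $p$ is strictly southwest or strictly northeast of $q$ and the smallest rectangle containing $p$ and $q$ is contained in $R_\nu$; otherwise they are $\nu$-compatible. A $\nu$-Schröder tree is a set $T$ of pairwise $\nu$-compatible lattice points in $R_\nu$ which includes the point $(0,a)$ (the root) and such that each row and each column of the grid contains at least one point of $T$. The parent of a non-root point $p\in T$ is the nearest point of $T$ above $p$ in its column, or the nearest point of $T$ to the left of $p$ in its row, if one of these exists (both cannot exist); otherwise it is the unique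 point $q\in T$ strictly northwest of $p$ such that the box with opposite corners $p,q$ contains no other point of $T$. Contractions of a $\nu$-Schröder tree $S$: (right) if $q\in S$ has a point of $S$ above it in its column and a point of $S$ to its right in its row, remove $q$; (left) if $q\in S$ has a point of $S$ to its left in its row and a point of $S$ below it in its column, remove $q$; (diagonal) if $r\in S$ is strictly southeast of its parent $p$, with neither of the other two corners of the box determined by $p$ and $r$ in $S$, and $S\setminus\{r\}$ is a $\nu$-Schröder tree, remove $r$. The poset of $\nu$-Schröder trees has cover relation $T\prec T'$ iff $T'$ is a contraction of $T$. The paper shows this poset is isomorphic to its contraction poset of $\nu$-Schröder paths, so $P_\nu$ may be taken to be either.
   Formalization: As stated the second claim fails (empty ν; ν=EENN), so ν is taken non-empty and "sublattice" means: a lattice embedded with the induced order, closed under all meets of the face lattice and under all joins except those whose join in the hat poset is the adjoined maximum. -}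

module Defs where

open import Data.Bool.Base using (Bool; T; _∧_; not)
open import Data.Bool.Properties using (⇔→≡; T-≡; T-∧)
open import Data.Fin.Base as Fin using (Fin; toℕ)
open import Data.List.Base using (List; []; _∷_; _++_; concat; length; replicate)
open import Data.Nat.Base using (ℕ; zero; suc; _+_; _≤_; _<_; _⊓_; _⊔_)
open import Data.Nat.Properties using (_≟_)
open import Data.Product.Base using (Σ; ∃; ∃₂; ∃-syntax; _×_; _,_; proj₁; proj₂)
open import Data.Product.Properties using (≡-dec)
open import Data.Sum.Base using (_⊎_; inj₁; inj₂)
open import Function.Base using (id; _∘_)
open import Function.Bundles using (Equivalence; mk⇔)
open import Level using (0ℓ)
open import Relation.Binary.Bundles using (Poset)
open import Relation.Binary.Core using (Rel)
open import Relation.Binary.Construct.Closure.ReflexiveTransitive using (Star; ε; _◅_; _◅◅_)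
import Relation.Binary.Construct.Add.Infimum.NonStrict as AddInfimum
import Relation.Binary.Construct.Add.Extrema.NonStrict as AddExtrema
open import Relation.Binary.Morphism.Structures using (IsOrderIsomorphism; IsOrderMonomorphism)
open import Relation.Binary.Lattice.Structures using (IsLattice)
open import Relation.Binary.PropositionalEquality using (_≡_; _≢_; _≗_; refl; sym; trans; subst)
open import Relation.Nullary.Decidable.Core using (⌊_⌋)
open import Relation.Nullary.Negation.Core using (¬_)
open import Relation.Nullary.Construct.Add.Extrema using (⊤±)

-- Sets of lattice points and sets of diagonals are Boolean-valued functions,
-- compared extensionally by _≗_.

BSet : Set → Set
BSet A = A → Bool

module _ {A : Set} where

  infix 4 _∈_ _∉_ _⊆_

  _∈_ _∉_ : A → BSet A → Set
  x ∈ S = T (S x)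
  x ∉ S = ¬ (x ∈ S)

  _⊆_ : Rel (BSet A) 0ℓ
  S ⊆ S′ = ∀ x → x ∈ S → x ∈ S′

  ≗⇒⊇ : {S S′ : BSet A} → S ≗ S′ → S′ ⊆ S
  ≗⇒⊇ eq x = subst T (sym (eq x))

  ⊆-antisym : {S S′ : BSet A} → S ⊆ S′ → S′ ⊆ S → S ≗ S′
  ⊆-antisym p q x = ⇔→≡ (mk⇔
    (Equivalence.to T-≡ ∘ p x ∘ Equivalence.from T-≡)
    (Equivalence.to T-≡ ∘ q x ∘ Equivalence.from T-≡))

data Step : Set where
  N E : Step

LatticePath : Set
LatticePath = List Step

norths easts : LatticePath → ℕ
norths []      = 0
norths (N ∷ ν) = suc (norths ν)
norths (E ∷ ν) = norths ν
easts []      = 0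
easts (N ∷ ν) = easts ν
easts (E ∷ ν) = suc (easts ν)

-- (x , y): column x, row y.
Point : Set
Point = ℕ × ℕ

xOf yOf : Point → ℕ
xOf = proj₁
yOf = proj₂

OnPath : LatticePath → Point → Set
OnPath ν p = ∃₂ λ μ ρ → ν ≡ μ ++ ρ × p ≡ (easts μ , norths μ)

Region : LatticePath → Point → Set
Region ν (x , y) =
  x ≤ easts ν × y ≤ norths ν × ∃[ h ] (OnPath ν (x , h) × h ≤ y)

infix 4 _◿_

-- p ◿ q: p is strictly southwest of q.
_◿_ : Rel Point 0ℓ
p ◿ q = xOf p < xOf q × yOf p < yOf q

-- r lies in the smallest rectangle containing p and q.
InBox : Point → Point → Point → Set
InBox p q r =
  (xOf p ⊓ xOf q ≤ xOf r × xOf r ≤ xOf p ⊔ xOf q) ×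
  (yOf p ⊓ yOf q ≤ yOf r × yOf r ≤ yOf p ⊔ yOf q)

-- Containment of the rectangle in the region is tested on lattice points.
-- Since ν is monotone, this is the same as containment of plane regions: both
-- say that the southeast corner of the rectangle is weakly above ν.
Incompatible : LatticePath → Rel Point 0ℓ
Incompatible ν p q = (p ◿ q ⊎ q ◿ p) × (∀ r → InBox p q r → Region ν r)

Compatible : LatticePath → Rel Point 0ℓ
Compatible ν p q = ¬ Incompatible ν p q

record IsSchröderTree (ν : LatticePath) (S : BSet Point) : Set where
  field
    inRegion   : ∀ p → p ∈ S → Region ν p
    compatible : ∀ p q → p ∈ S → q ∈ S → Compatible ν p q
    root       : (0 , norths ν) ∈ S
    rows       : ∀ y → y ≤ norths ν → ∃[ x ] (x , y) ∈ S
    columns    : ∀ x → x ≤ easts ν → ∃[ y ] (x , y) ∈ S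

SchröderTree : LatticePath → Set
SchröderTree ν = Σ (BSet Point) (IsSchröderTree ν)

points : ∀ {ν} → SchröderTree ν → BSet Point
points = proj₁

module _ (S : BSet Point) where

  HasAbove HasBelow HasLeft HasRight : Point → Set
  HasAbove p = ∃[ q ] (q ∈ S × xOf q ≡ xOf p × yOf p < yOf q)
  HasBelow p = ∃[ q ] (q ∈ S × xOf q ≡ xOf p × yOf q < yOf p)
  HasLeft  p = ∃[ q ] (q ∈ S × yOf q ≡ yOf p × xOf q < xOf p)
  HasRight p = ∃[ q ] (q ∈ S × yOf q ≡ yOf p × xOf p < xOf q)

  -- Parent p q: q is the parent of p.
  data Parent (p q : Point) : Set where
    above    : q ∈ S → xOf q ≡ xOf p → yOf p < yOf q →
               (∀ r → r ∈ S → xOf r ≡ xOf p → yOf p < yOf r → yOf q ≤ yOf r) →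
               Parent p q
    left     : q ∈ S → yOf q ≡ yOf p → xOf q < xOf p →
               (∀ r → r ∈ S → yOf r ≡ yOf p → xOf r < xOf p → xOf r ≤ xOf q) →
               Parent p q
    diagonal : ¬ HasAbove p → ¬ HasLeft p →
               q ∈ S → xOf q < xOf p → yOf p < yOf q →
               (∀ r → r ∈ S → InBox p q r → r ≡ p ⊎ r ≡ q) →
               Parent p q

infixl 7 _∖_

_∖_ : BSet Point → Point → BSet Point
(S ∖ q) p = S p ∧ not ⌊ ≡-dec _≟_ _≟_ p q ⌋

-- Contractible ν S q: one of the three contractions of S removes q.
data Contractible (ν : LatticePath) (S : BSet Point) (q : Point) : Set where
  right    : HasAbove S q → HasRight S q → Contractible ν S q
  left     : HasLeft S q → HasBelow S q → Contractible ν S q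
  diagonal : ∀ p → Parent S q p → xOf p < xOf q → yOf q < yOf p →
             (xOf p , yOf q) ∉ S → (xOf q , yOf p) ∉ S →
             IsSchröderTree ν (S ∖ q) → Contractible ν S q

module _ (ν : LatticePath) where

  infix 4 _≈ᵀ_ _⋖_ _≤ᵀ_

  _≈ᵀ_ : Rel (SchröderTree ν) 0ℓ
  S ≈ᵀ S′ = points S ≗ points S′

  _⋖_ : Rel (SchröderTree ν) 0ℓ
  S ⋖ S′ = ∃[ q ] (q ∈ points S × Contractible ν (points S) q ×
                   points S′ ≗ points S ∖ q)

  -- The partial order generated by _⋖_.  Extensionally equal sets are
  -- identified, so _≈ᵀ_ has to be included explicitly.
  _≤ᵀ_ : Rel (SchröderTree ν) 0ℓ
  _≤ᵀ_ = Star (λ S S′ → S ≈ᵀ S′ ⊎ S ⋖ S′)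

  ≤ᵀ⇒⊇ : ∀ {S S′} → S ≤ᵀ S′ → points S′ ⊆ points S
  ≤ᵀ⇒⊇ ε                                p = id
  ≤ᵀ⇒⊇ (inj₁ eq ◅ rest)                 p = ≗⇒⊇ eq p ∘ ≤ᵀ⇒⊇ rest p
  ≤ᵀ⇒⊇ (inj₂ (q , _ , _ , eq) ◅ rest)   p =
    proj₁ ∘ Equivalence.to T-∧ ∘ subst T (eq p) ∘ ≤ᵀ⇒⊇ rest p

  treePoset : Poset 0ℓ 0ℓ 0ℓ
  treePoset = record
    { Carrier        = SchröderTree ν
    ; _≈_            = _≈ᵀ_
    ; _≤_            = _≤ᵀ_
    ; isPartialOrder = record
      { isPreorder = record
        { isEquivalence = record
          { refl  = λ _ → refl
          ; sym   = λ p x → sym (p x)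
          ; trans = λ p q x → trans (p x) (q x)
          }
        ; reflexive = λ eq → inj₁ eq ◅ ε
        ; trans     = _◅◅_
        }
      ; antisym = λ {S} {S′} p q →
          ⊆-antisym (≤ᵀ⇒⊇ {S′} {S} q) (≤ᵀ⇒⊇ {S} {S′} p)
      }
    }

module _ (k : ℕ) where

  -- The vertices of the k-gon are numbered cyclically by Fin k; the segment
  -- joining two distinct vertices i < j is represented by the pair (i , j).
  Segment : Set
  Segment = Fin k × Fin k

  IsDiagonal : Segment → Set
  IsDiagonal (i , j) = suc (toℕ i) < toℕ j × ¬ (toℕ i ≡ 0 × suc (toℕ j) ≡ k)

  Crosses : Rel Segment 0ℓ
  Crosses (i , j) (i′ , j′) =
    (i Fin.< i′ × i′ Fin.< j × j Fin.< j′) ⊎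
    (i′ Fin.< i × i Fin.< j′ × j′ Fin.< j)

  record IsDissection (D : BSet Segment) : Set where
    field
      diagonals   : ∀ d → d ∈ D → IsDiagonal d
      nonCrossing : ∀ d e → d ∈ D → e ∈ D → ¬ Crosses d e

  Dissection : Set
  Dissection = Σ (BSet Segment) IsDissection

  -- D is below D′ when D′ is coarser than D.
  dissectionPoset : Poset 0ℓ 0ℓ 0ℓ
  dissectionPoset = record
    { Carrier        = Dissection
    ; _≈_            = λ D D′ → proj₁ D ≗ proj₁ D′
    ; _≤_            = λ D D′ → proj₁ D′ ⊆ proj₁ D
    ; isPartialOrder = record
      { isPreorder = record
        { isEquivalence = record
          { refl  = λ _ → refl
          ; sym   = λ p x → sym (p x)
          ; trans = λ p q x → trans (p x) (q x)
          }
        ; reflexive = ≗⇒⊇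
        ; trans     = λ p q x → p x ∘ q x
        }
      ; antisym = λ p q → ⊆-antisym q p
      }
    }

add0̂ : Poset 0ℓ 0ℓ 0ℓ → Poset 0ℓ 0ℓ 0ℓ
add0̂ P = record
  { isPartialOrder = AddInfimum.≤₋-isPartialOrder _ (Poset.isPartialOrder P) }

add0̂1̂ : Poset 0ℓ 0ℓ 0ℓ → Poset 0ℓ 0ℓ 0ℓ
add0̂1̂ P = record
  { isPartialOrder = AddExtrema.≤±-isPartialOrder _ (Poset.isPartialOrder P) }

-- The non-empty faces of the n-associahedron are the dissections of the
-- (n+3)-gon; the adjoined minimum is the empty face.
faceLattice : ℕ → Poset 0ℓ 0ℓ 0ℓ
faceLattice n = add0̂ (dissectionPoset (n + 3))

[NE]^ : ℕ → LatticePath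
[NE]^ k = concat (replicate k (N ∷ E ∷ []))

module _ (P Q : Poset 0ℓ 0ℓ 0ℓ) where
  private
    module P = Poset P
    module Q = Poset Q

  Isomorphic : Set
  Isomorphic = ∃ (IsOrderIsomorphism P._≈_ Q._≈_ P._≤_ Q._≤_)

  OrderEmbedding : (P.Carrier → Q.Carrier) → Set
  OrderEmbedding = IsOrderMonomorphism P._≈_ Q._≈_ P._≤_ Q._≤_

-- P with an adjoined 0̂ and 1̂ is a lattice, L is a lattice, and the former is
-- isomorphic to a subset of L, with the induced order, that is closed under
-- the meets of L and under those joins of L that correspond to joins other
-- than 1̂.
--
-- Closure under the remaining joins cannot be demanded when P is P_ν and L is
-- the face lattice of an associahedron.  For ν = EENN, the trees above the
-- tree {(0,2),(1,2),(1,1),(2,1),(2,0)}, together with 1̂, form a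
-- non-distributive interval, whereas every interval above a non-empty face of
-- a simple polytope is Boolean.
record HatSublattice (P L : Poset 0ℓ 0ℓ 0ℓ) : Set where
  private
    module P̂ = Poset (add0̂1̂ P)
    module L = Poset L
  field
    _∨ᴾ_ _∧ᴾ_   : P̂.Carrier → P̂.Carrier → P̂.Carrier
    isLattice   : IsLattice P̂._≈_ P̂._≤_ _∨ᴾ_ _∧ᴾ_
    _∨ᴸ_ _∧ᴸ_   : L.Carrier → L.Carrier → L.Carrier
    isLatticeᴸ  : IsLattice L._≈_ L._≤_ _∨ᴸ_ _∧ᴸ_
    ⟦_⟧         : P̂.Carrier → L.Carrier
    isEmbedding : OrderEmbedding (add0̂1̂ P) L ⟦_⟧
    ∧-homo      : ∀ x y → ⟦ x ∧ᴾ y ⟧ L.≈ ⟦ x ⟧ ∧ᴸ ⟦ y ⟧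
    ∨-homo      : ∀ x y → ¬ (x ∨ᴾ y P̂.≈ ⊤±) → ⟦ x ∨ᴾ y ⟧ L.≈ ⟦ x ⟧ ∨ᴸ ⟦ y ⟧

{-# OPTIONS --safe #-}

module Submission where

-- Contracting a tree removes a point, and conversely, if S′ ⊂ S are two trees,
-- every point of S outside S′ can be contracted in S: the order of trees is
-- reverse inclusion.  Let ν have m steps.  The steps of EνN form a word in
-- which column x corresponds to the x-th E and row y to the y-th N, and (x , y)
-- lies in the region iff the former precedes the latter.  Numbering the
-- vertices of the (m + 3)-gon along this word, with the labels of the rows
-- shifted by one, makes the points of the region diagonals, except for the
-- root, which becomes an edge; incompatible points become crossing diagonals.
-- Hence trees become dissections, unions (meets, when compatible) become
-- unions, and intersections (joins, when they are trees) become intersections.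
-- If ν = (NE)^(n+1), then (x , y) ↦ {x , y + 1} does the same with an
-- (n + 3)-gon.  The points sent to edges are the root and the (x , x), which
-- belong to every tree, so that every dissection arises from a tree.

open import Defs
open import Data.Bool.Base using (T; false; _∧_; _∨_; not)
open import Data.Bool.Properties using (T?; T-∧; T-∨)
open import Data.Empty using (⊥-elim)
open import Data.Fin.Base using (toℕ; fromℕ<)
import Data.Fin.Base as Fin
import Data.Fin.Properties as Fin
open import Data.List.Base using (List; []; _∷_; length; upTo; cartesianProduct)
import Data.List.Membership.Propositional as List
open import Data.List.Membership.Propositional.Properties using (∈-cartesianProduct⁺; ∈-upTo⁺)
open import Data.List.Relation.Unary.Any using (here; there)
open import Data.Nat.Base
open import Data.Nat.Induction using (<-wellFounded)
open import Data.Nat.Properties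
open import Data.Product.Base using (∃; ∃-syntax; _×_; _,_; proj₁; proj₂)
open import Data.Product.Properties using (≡-dec)
open import Data.Sum.Base using (_⊎_; inj₁; inj₂; [_,_]′)
open import Function.Base using (id; _∘_; case_of_)
open import Function.Bundles using (Equivalence)
open import Induction.WellFounded using (Acc; acc)
open import Level using (0ℓ)
open import Relation.Binary.Bundles using (Poset)
open import Relation.Binary.Core using (Rel)
open import Relation.Binary.Construct.Add.Infimum.NonStrict using (⊥₋≤_; [_])
open import Relation.Binary.Construct.Add.Point.Equality using (∙≈∙; [_])
open import Relation.Binary.Construct.Add.Supremum.NonStrict using (_≤⊤⁺; [_])
open import Relation.Binary.Construct.Closure.ReflexiveTransitive using (ε; _◅_)
open import Relation.Binary.Definitions using (tri<; tri≈; tri>)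
open import Relation.Binary.Lattice.Definitions using (Supremum; Infimum)
open import Relation.Binary.Lattice.Structures using (IsLattice)
open import Relation.Binary.Morphism.Structures using (IsOrderMonomorphism)
open import Relation.Binary.PropositionalEquality hiding ([_])
open import Relation.Nullary.Decidable using
  (Dec; yes; no; ⌊_⌋; toWitness; fromWitness; map′; _×-dec_; _⊎-dec_; _→-dec_; ¬?)
open import Relation.Nullary.Construct.Add.Infimum using (⊥₋; [_])
open import Relation.Nullary.Construct.Add.Supremum using (⊤⁺)
open import Relation.Nullary.Negation.Core using (¬_)

-- Polygon vertices along the path, and the region

-- The positions of the x-th E in EνN, and of the y-th N plus one.
colVertex : LatticePath → ℕ → ℕ
colVertex ν       zero    = 0
colVertex []      (suc x) = suc x
colVertex (N ∷ ν) (suc x) = suc (colVertex ν (suc x))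
colVertex (E ∷ ν) (suc x) = suc (colVertex ν x)

rowVertex : LatticePath → ℕ → ℕ
rowVertex []      y       = 2 + y
rowVertex (N ∷ ν) zero    = 2
rowVertex (N ∷ ν) (suc y) = suc (rowVertex ν y)
rowVertex (E ∷ ν) y       = suc (rowVertex ν y)

-- Beyond the last column the values simply continue upwards, as do those of `rowVertex` beyond the
-- last row, so monotonicity holds on all of ℕ without bounds.
colVertex-mono : ∀ ν {x x′} → x < x′ → colVertex ν x < colVertex ν x′
colVertex-mono []      {zero}  {suc x′} x<x′       = x<x′
colVertex-mono []      {suc x} {suc x′} x<x′       = x<x′
colVertex-mono (N ∷ ν) {zero}  {suc x′} _          = z<s
colVertex-mono (N ∷ ν) {suc x} {suc x′} x<x′       = s<s (colVertex-mono ν x<x′)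
colVertex-mono (E ∷ ν) {zero}  {suc x′} _          = z<s
colVertex-mono (E ∷ ν) {suc x} {suc x′} (s<s x<x′) = s<s (colVertex-mono ν x<x′)

2≤rowVertex : ∀ ν y → 2 ≤ rowVertex ν y
2≤rowVertex []      y       = s≤s (s≤s z≤n)
2≤rowVertex (N ∷ ν) zero    = ≤-refl
2≤rowVertex (N ∷ ν) (suc y) = m≤n⇒m≤1+n (2≤rowVertex ν y)
2≤rowVertex (E ∷ ν) y       = m≤n⇒m≤1+n (2≤rowVertex ν y)

rowVertex-mono : ∀ ν {y y′} → y < y′ → rowVertex ν y < rowVertex ν y′
rowVertex-mono []      y<y′                         = s<s (s<s y<y′)
rowVertex-mono (N ∷ ν) {zero}  {suc y′} _           = s≤s (2≤rowVertex ν y′)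
rowVertex-mono (N ∷ ν) {suc y} {suc y′} (s<s y<y′)  = s<s (rowVertex-mono ν y<y′)
rowVertex-mono (E ∷ ν) y<y′                         = s<s (rowVertex-mono ν y<y′)

rowVertex-norths : ∀ ν → rowVertex ν (norths ν) ≡ 2 + length ν
rowVertex-norths []      = refl
rowVertex-norths (N ∷ ν) = cong suc (rowVertex-norths ν)
rowVertex-norths (E ∷ ν) = cong suc (rowVertex-norths ν)

region-bounds : ∀ {ν x y} → Region ν (x , y) → x ≤ easts ν × y ≤ norths ν
region-bounds (x≤ , y≤ , _) = x≤ , y≤

region-zero : ∀ ν {y} → y ≤ norths ν → Region ν (0 , y)
region-zero ν y≤ = z≤n , y≤ , 0 , ([] , ν , refl , refl) , z≤n

region-N⁺ : ∀ {ν x y} → Region ν (x , y) → Region (N ∷ ν) (x , suc y)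
region-N⁺ (x≤ , y≤ , h , (μ , ρ , ν≡ , refl) , h≤) =
  x≤ , s≤s y≤ , suc h , (N ∷ μ , ρ , cong (N ∷_) ν≡ , refl) , s≤s h≤

region-N⁻ : ∀ {ν x y} → Region (N ∷ ν) (suc x , suc y) → Region ν (suc x , y)
region-N⁻ (x≤ , s≤s y≤ , _ , (N ∷ μ , ρ , refl , eq) , h≤) =
  x≤ , y≤ , norths μ , (μ , ρ , refl , cong (_, norths μ) (cong proj₁ eq)) ,
  s≤s⁻¹ (subst (_≤ _) (cong proj₂ eq) h≤)

region-N-zero : ∀ {ν x} → ¬ Region (N ∷ ν) (suc x , 0)
region-N-zero (_ , _ , _ , ([] , _ , _ , ()) , _)
region-N-zero (_ , _ , _ , (N ∷ μ , ρ , refl , eq) , h≤) = case subst (_≤ 0) (cong proj₂ eq) h≤ of λ ()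

region-E⁺ : ∀ {ν x y} → Region ν (x , y) → Region (E ∷ ν) (suc x , y)
region-E⁺ (x≤ , y≤ , h , (μ , ρ , ν≡ , refl) , h≤) =
  s≤s x≤ , y≤ , h , (E ∷ μ , ρ , cong (E ∷_) ν≡ , refl) , h≤

region-E⁻ : ∀ {ν x y} → Region (E ∷ ν) (suc x , y) → Region ν (x , y)
region-E⁻ (s≤s x≤ , y≤ , _ , (E ∷ μ , ρ , refl , refl) , h≤) =
  x≤ , y≤ , _ , (μ , ρ , refl , refl) , h≤

-- The shift of the row labels turns precedence in the word EνN into a gap of at least two, so that
-- no point of the region is sent to an edge between consecutive vertices.
region⇒col<row : ∀ ν {x y} → Region ν (x , y) → suc (colVertex ν x) < rowVertex ν y
region⇒col<row ν       {zero}  {y}     r = 2≤rowVertex ν y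
region⇒col<row []      {suc x} {y}     (() , _)
region⇒col<row (N ∷ ν) {suc x} {zero}  r = ⊥-elim (region-N-zero r)
region⇒col<row (N ∷ ν) {suc x} {suc y} r = s<s (region⇒col<row ν (region-N⁻ r))
region⇒col<row (E ∷ ν) {suc x} {y}     r = s<s (region⇒col<row ν (region-E⁻ r))

-- An E and an N never occupy the same position, so the inequality without the gap already gives
-- precedence.
col<row⇒region : ∀ ν {x y} → x ≤ easts ν → y ≤ norths ν →
                    colVertex ν x < rowVertex ν y → Region ν (x , y)
col<row⇒region ν       {zero}          _        y≤       _        = region-zero ν y≤
col<row⇒region (N ∷ ν) {suc x} {zero}  _        _        (s<s l)  =
  ⊥-elim (<⇒≱ l (colVertex-mono ν z<s))
col<row⇒region (N ∷ ν) {suc x} {suc y} x≤       (s≤s y≤) (s<s l)  =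
  region-N⁺ (col<row⇒region ν x≤ y≤ l)
col<row⇒region (E ∷ ν) {suc x}         (s≤s x≤) y≤       (s<s l)  =
  region-E⁺ (col<row⇒region ν x≤ y≤ l)

strict⇒weak : (f : ℕ → ℕ) → (∀ {m n} → m < n → f m < f n) → ∀ {m n} → m ≤ n → f m ≤ f n
strict⇒weak f mono m≤n with m≤n⇒m<n∨m≡n m≤n
... | inj₁ m<n  = <⇒≤ (mono m<n)
... | inj₂ refl = ≤-refl

strict⇒cancel-< : (f : ℕ → ℕ) → (∀ {m n} → m < n → f m < f n) → ∀ {m n} → f m < f n → m < n
strict⇒cancel-< f mono fm<fn = ≰⇒> (<⇒≱ fm<fn ∘ strict⇒weak f mono)

strict⇒injective : (f : ℕ → ℕ) → (∀ {m n} → m < n → f m < f n) → ∀ {m n} → f m ≡ f n → m ≡ n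
strict⇒injective f mono {m} {n} eq with <-cmp m n
... | tri< m<n _ _ = ⊥-elim (<-irrefl eq (mono m<n))
... | tri≈ _ m≡n _ = m≡n
... | tri> _ _ n<m = ⊥-elim (<-irrefl (sym eq) (mono n<m))

-- Moving west lowers the column vertex and moving north raises the row vertex, so the inequality
-- between them persists.
region-northwest : ∀ {ν x y x′ y′} → Region ν (x , y) → x′ ≤ x → y ≤ y′ → y′ ≤ norths ν →
                   Region ν (x′ , y′)
region-northwest {ν} r x′≤x y≤y′ y′≤a = col<row⇒region ν
  (≤-trans x′≤x (proj₁ (region-bounds r))) y′≤a
  (<-≤-trans (≤-<-trans (strict⇒weak (colVertex ν) (colVertex-mono ν) x′≤x)
                        (<⇒≤ (region⇒col<row ν r)))
             (strict⇒weak (rowVertex ν) (rowVertex-mono ν) y≤y′))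

southeast-corner : ∀ {p q} → p ◿ q → InBox p q (xOf q , yOf p)
southeast-corner (x< , y<) =
  (m⊓n≤n _ _ , m≤n⊔m _ _) , (m⊓n≤m _ _ , m≤m⊔n _ _)

-- Every point of the box lies weakly northwest of its southeast corner, so testing that corner is
-- enough.
incompatible⁺ : ∀ {ν p q} → p ◿ q → Region ν (xOf q , yOf p) → Region ν q → Incompatible ν p q
incompatible⁺ p◿q@(x< , y<) corner (_ , yq≤ , _) = inj₁ p◿q , λ r ((_ , xr≤) , (≤yr , yr≤)) →
  region-northwest corner
    (subst (_ ≤_) (m≤n⇒m⊔n≡n (<⇒≤ x<)) xr≤)
    (subst (_≤ _) (m≤n⇒m⊓n≡m (<⇒≤ y<)) ≤yr)
    (≤-trans (subst (_ ≤_) (m≤n⇒m⊔n≡n (<⇒≤ y<)) yr≤) yq≤)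

incompatible-sym : ∀ {ν p q} → Incompatible ν p q → Incompatible ν q p
incompatible-sym {ν} {p} {q} (s , box) = [ inj₂ , inj₁ ]′ s , λ r ((a , b) , (c , d)) → box r
  ( (subst (_≤ _) (⊓-comm (xOf q) (xOf p)) a , subst (_ ≤_) (⊔-comm (xOf q) (xOf p)) b)
  , (subst (_≤ _) (⊓-comm (yOf q) (yOf p)) c , subst (_ ≤_) (⊔-comm (yOf q) (yOf p)) d))

inBox-northwest : ∀ {p q r} → xOf q ≤ xOf p → yOf p ≤ yOf q → InBox p q r →
                  (xOf q ≤ xOf r × xOf r ≤ xOf p) × (yOf p ≤ yOf r × yOf r ≤ yOf q)
inBox-northwest xq≤ yp≤ ((a , b) , (c , d)) =
  ( subst (_≤ _) (m≥n⇒m⊓n≡n xq≤) a , subst (_ ≤_) (m≥n⇒m⊔n≡m xq≤) b) ,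
  ( subst (_≤ _) (m≤n⇒m⊓n≡m yp≤) c , subst (_ ≤_) (m≤n⇒m⊔n≡n yp≤) d)

-- The order of trees is reverse inclusion

∈-∖⁺ : ∀ {S p q} → p ∈ S → p ≢ q → p ∈ S ∖ q
∈-∖⁺ p∈S p≢q = Equivalence.from T-∧ (p∈S , fromWitnessNot p≢q)
  where
  fromWitnessNot : ∀ {p q : Point} → p ≢ q → T (not ⌊ ≡-dec _≟_ _≟_ p q ⌋)
  fromWitnessNot {p} {q} p≢q with ≡-dec _≟_ _≟_ p q
  ... | yes eq = p≢q eq
  ... | no _   = _

∈-∖⁻ : ∀ {S p q} → p ∈ S ∖ q → p ∈ S × p ≢ q
∈-∖⁻ {S} {p} {q} p∈ with ≡-dec _≟_ _≟_ p q | Equivalence.to (T-∧ {S p}) p∈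
... | no p≢q | p∈S , _ = p∈S , p≢q

module _ {ν : LatticePath} {S : BSet Point} (tree : IsSchröderTree ν S) where
  open IsSchröderTree tree

  x≤easts : ∀ {x y} → (x , y) ∈ S → x ≤ easts ν
  x≤easts p∈S = proj₁ (region-bounds (inRegion _ p∈S))

  y≤norths : ∀ {x y} → (x , y) ∈ S → y ≤ norths ν
  y≤norths p∈S = proj₂ (region-bounds (inRegion _ p∈S))

  intermediate-tree : ∀ {S′ S″} → IsSchröderTree ν S′ → S′ ⊆ S″ → S″ ⊆ S → IsSchröderTree ν S″
  intermediate-tree tree′ ⊆₁ ⊆₂ = record
    { inRegion   = λ p p∈ → inRegion p (⊆₂ p p∈)
    ; compatible = λ p q p∈ q∈ → compatible p q (⊆₂ p p∈) (⊆₂ q q∈)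
    ; root       = ⊆₁ _ T′.root
    ; rows       = λ y y≤ → let x , p∈ = T′.rows y y≤ in x , ⊆₁ _ p∈
    ; columns    = λ x x≤ → let y , p∈ = T′.columns x x≤ in y , ⊆₁ _ p∈
    }
    where module T′ = IsSchröderTree tree′

  -- The two neighbours would span a box with southeast corner `q`, hence be incompatible.
  no-left-and-above : ∀ {q} → q ∈ S → HasLeft S q → HasAbove S q → ∀ {ℓ} {A : Set ℓ} → A
  no-left-and-above q∈S ((_ , _) , u∈S , refl , u<) ((_ , _) , v∈S , refl , <v) =
    ⊥-elim (compatible _ _ u∈S v∈S (incompatible⁺ (u< , <v) (inRegion _ q∈S) (inRegion _ v∈S)))

  hasLeft? : ∀ q → Dec (HasLeft S q)
  hasLeft? (x , y) = map′
    (λ (x′ , x′<x , p∈) → (x′ , y) , p∈ , refl , x′<x)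
    (λ { ((x′ , _) , p∈ , refl , x′<x) → x′ , x′<x , p∈ })
    (anyUpTo? (λ x′ → T? (S (x′ , y))) x)

  hasAbove? : ∀ q → Dec (HasAbove S q)
  hasAbove? (x , y) = map′
    (λ (y′ , _ , p∈ , y<y′) → (x , y′) , p∈ , refl , y<y′)
    (λ { ((_ , y′) , p∈ , refl , y<y′) → y′ , s≤s (y≤norths p∈) , p∈ , y<y′ })
    (anyUpTo? (λ y′ → T? (S (x , y′)) ×-dec y <? y′) (suc (norths ν)))

  module _ {q} (q∈S : q ∈ S) (¬left : ¬ HasLeft S q) (¬above : ¬ HasAbove S q) where

    Northwest : Point → Set
    Northwest p = p ∈ S × xOf p < xOf q × yOf q < yOf p

    -- The measure that terminates the search for a parent. Up to a constant it is the
    -- half-perimeter of the box between `p` and `q`.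
    distance : Point → ℕ
    distance p = (xOf q ∸ xOf p) + yOf p

    Interior : Point → Point → Set
    Interior p r = r ∈ S × (xOf p ≤ xOf r × xOf r ≤ xOf q) × (yOf q ≤ yOf r × yOf r ≤ yOf p) ×
                   r ≢ q × r ≢ p

    interior? : ∀ p → Dec (∃ (Interior p))
    interior? p = map′
      (λ (x , _ , y , _ , i) → (x , y) , i)
      (λ ((x , y) , i@(_ , (_ , x≤) , (_ , y≤) , _)) → x , s≤s x≤ , y , s≤s y≤ , i)
      (anyUpTo? (λ x → anyUpTo? (λ y →
        T? (S (x , y)) ×-dec
        (xOf p ≤? x ×-dec x ≤? xOf q) ×-dec (yOf q ≤? y ×-dec y ≤? yOf p) ×-dec
        ¬? (≡-dec _≟_ _≟_ (x , y) q) ×-dec ¬? (≡-dec _≟_ _≟_ (x , y) p))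
        (suc (yOf p))) (suc (xOf q)))

    -- A point of the box in the row or column of `q` would be to the left of `q` or above it; hence
    -- `r` is again strictly northwest of `q`, and its box is smaller.
    interior⇒closer : ∀ {p r} → Northwest p → Interior p r → Northwest r × distance r < distance p
    interior⇒closer {p} {r} (p∈S , xp< , <yp) (r∈S , (xp≤ , xr≤) , (yq≤ , yr≤) , r≢q , r≢p) =
      (r∈S , xr<xq , yq<yr) , closer
      where
      xr<xq : xOf r < xOf q
      xr<xq with m≤n⇒m<n∨m≡n xr≤ | m≤n⇒m<n∨m≡n yq≤
      ... | inj₁ lt   | _         = lt
      ... | inj₂ refl | inj₁ lt   = ⊥-elim (¬above (r , r∈S , refl , lt))
      ... | inj₂ refl | inj₂ refl = ⊥-elim (r≢q refl)
      yq<yr : yOf q < yOf r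
      yq<yr with m≤n⇒m<n∨m≡n yq≤
      ... | inj₁ lt   = lt
      ... | inj₂ refl = ⊥-elim (¬left (r , r∈S , refl , xr<xq))
      closer : distance r < distance p
      closer with m≤n⇒m<n∨m≡n xp≤ | m≤n⇒m<n∨m≡n yr≤
      ... | inj₁ lt   | _         = +-mono-<-≤ (∸-monoʳ-< lt xr≤) yr≤
      ... | inj₂ refl | inj₁ lt   = +-monoʳ-< (xOf q ∸ xOf p) lt
      ... | inj₂ refl | inj₂ refl = ⊥-elim (r≢p refl)

    -- As long as the box contains a further point, that point replaces `p`; an empty box makes `p`
    -- the parent.
    diagonal-parent : ∀ p → Northwest p → Acc _<_ (distance p) →
                      ∃[ p′ ] (Parent S q p′ × xOf p′ < xOf q × yOf q < yOf p′)
    diagonal-parent p nw@(p∈S , xp< , <yp) (acc rec) with interior? p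
    ... | yes (r , i) = let nw′ , closer = interior⇒closer nw i in
      diagonal-parent r nw′ (rec closer)
    ... | no ¬i = p , diagonal ¬above ¬left p∈S xp< <yp empty , xp< , <yp
      where
      empty : ∀ r → r ∈ S → InBox q p r → r ≡ q ⊎ r ≡ p
      empty r r∈S box with ≡-dec _≟_ _≟_ r q | ≡-dec _≟_ _≟_ r p
      ... | yes eq | _      = inj₁ eq
      ... | no _   | yes eq = inj₂ eq
      ... | no ≢q  | no ≢p  =
        let bx , by = inBox-northwest (<⇒≤ xp<) (<⇒≤ <yp) box in
        ⊥-elim (¬i (r , r∈S , bx , by , ≢q , ≢p))

    -- Provides the start of the search. Sharing a row or column with `q`, the root would be to its
    -- left or above it.
    root-northwest : q ≢ (0 , norths ν) → Northwest (0 , norths ν)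
    root-northwest q≢root = root , 0<x , y<a
      where
      0<x : 0 < xOf q
      0<x with m≤n⇒m<n∨m≡n (z≤n {xOf q}) | m≤n⇒m<n∨m≡n (y≤norths q∈S)
      ... | inj₁ lt   | _         = lt
      ... | inj₂ refl | inj₁ lt   = ⊥-elim (¬above (_ , root , refl , lt))
      ... | inj₂ refl | inj₂ refl = ⊥-elim (q≢root refl)
      y<a : yOf q < norths ν
      y<a with m≤n⇒m<n∨m≡n (y≤norths q∈S)
      ... | inj₁ lt   = lt
      ... | inj₂ refl = ⊥-elim (¬left (_ , root , refl , 0<x))

  -- `S′` has points in the row and in the column of `q`, all different from `q`. Left and below, or
  -- right and above, they give a contraction at once; left and above they cannot be. If they are
  -- right and below, a further point of `S` to the left or above helps, and otherwise the
  -- contraction is diagonal.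
  extra⇒contractible : ∀ {S′ q} → IsSchröderTree ν S′ → S′ ⊆ S → q ∈ S → q ∉ S′ →
                       Contractible ν S q
  extra⇒contractible {S′} {q@(x , y)} tree′ S′⊆S q∈S q∉S′
    with T′.rows y (y≤norths q∈S) | T′.columns x (x≤easts q∈S)
    where module T′ = IsSchröderTree tree′
  ... | x′ , u∈ | y′ , v∈ with <-cmp x′ x | <-cmp y′ y
  ... | tri≈ _ refl _ | _ = ⊥-elim (q∉S′ u∈)
  ... | _ | tri≈ _ refl _ = ⊥-elim (q∉S′ v∈)
  ... | tri< x′< _ _ | tri< y′< _ _ =
    left (_ , S′⊆S _ u∈ , refl , x′<) (_ , S′⊆S _ v∈ , refl , y′<)
  ... | tri< x′< _ _ | tri> _ _ <y′ =
    no-left-and-above q∈S (_ , S′⊆S _ u∈ , refl , x′<) (_ , S′⊆S _ v∈ , refl , <y′)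
  ... | tri> _ _ <x′ | tri> _ _ <y′ =
    right (_ , S′⊆S _ v∈ , refl , <y′) (_ , S′⊆S _ u∈ , refl , <x′)
  ... | tri> _ _ <x′ | tri< y′< _ _ with hasLeft? q | hasAbove? q
  ... | yes l | _     = left l (_ , S′⊆S _ v∈ , refl , y′<)
  ... | _     | yes a = right a (_ , S′⊆S _ u∈ , refl , <x′)
  ... | no ¬l | no ¬a =
    let nw = root-northwest q∈S ¬l ¬a λ { refl → q∉S′ (IsSchröderTree.root tree′) }
        p , parent , xp< , <yp = diagonal-parent q∈S ¬l ¬a _ nw (<-wellFounded _)
    in diagonal p parent xp< <yp
         (λ r∈ → ¬l (_ , r∈ , refl , xp<))
         (λ r∈ → ¬a (_ , r∈ , refl , <yp))
         -- Without `q`, the set still lies between `S′` and `S`.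
         (intermediate-tree tree′ (λ r r∈ → ∈-∖⁺ {S} (S′⊆S r r∈) λ { refl → q∉S′ r∈ })
                                  (λ r r∈ → proj₁ (∈-∖⁻ {S} r∈)))

module _ (ν : LatticePath) where

  -- Induction on a list that exhausts the difference of the two trees. Each point of the difference
  -- is contracted in turn, and the other entries are skipped.
  contractions : ∀ (ps : List Point) (S S′ : SchröderTree ν) → points {ν} S′ ⊆ points {ν} S →
                 (∀ p → p ∈ points {ν} S → p ∉ points {ν} S′ → p List.∈ ps) → _≤ᵀ_ ν S S′
  -- The trees now have the same points but need not be equal as terms, so the chain ends with an
  -- `_≈ᵀ_` step.
  contractions [] S S′ S′⊆S extra = inj₁ (⊆-antisym S⊆S′ S′⊆S) ◅ ε
    where
    S⊆S′ : points {ν} S ⊆ points {ν} S′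
    S⊆S′ p p∈S with T? (points {ν} S′ p)
    ... | yes p∈S′ = p∈S′
    ... | no  p∉S′ = case extra p p∈S p∉S′ of λ ()
  contractions (q ∷ ps) S@(_ , tree) S′@(_ , tree′) S′⊆S extra
    with T? (points {ν} S q) | T? (points {ν} S′ q)
  ... | yes q∈S | no q∉S′ =
    inj₂ (q , q∈S , extra⇒contractible tree tree′ S′⊆S q∈S q∉S′ , λ _ → refl)
      ◅ contractions ps (points {ν} S ∖ q , intermediate-tree tree tree′ S′⊆S∖q S∖q⊆S) S′
          S′⊆S∖q extra′
    where
    S′⊆S∖q : points {ν} S′ ⊆ points {ν} S ∖ q
    S′⊆S∖q r r∈ = ∈-∖⁺ {points {ν} S} (S′⊆S r r∈) λ { refl → q∉S′ r∈ }
    S∖q⊆S : points {ν} S ∖ q ⊆ points {ν} S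
    S∖q⊆S r r∈ = proj₁ (∈-∖⁻ {points {ν} S} r∈)
    extra′ : ∀ p → p ∈ points {ν} S ∖ q → p ∉ points {ν} S′ → p List.∈ ps
    extra′ p p∈ p∉ with p∈S , p≢q ← ∈-∖⁻ {points {ν} S} p∈ with extra p p∈S p∉
    ... | here p≡q   = ⊥-elim (p≢q p≡q)
    ... | there p∈ps = p∈ps
  ... | no q∉S | _ = contractions ps S S′ S′⊆S λ p p∈ p∉ → case extra p p∈ p∉ of λ where
    (here refl) → ⊥-elim (q∉S p∈)
    (there p∈ps) → p∈ps
  ... | yes _ | yes q∈S′ = contractions ps S S′ S′⊆S λ p p∈ p∉ → case extra p p∈ p∉ of λ where
    (here refl) → ⊥-elim (p∉ q∈S′)
    (there p∈ps) → p∈ps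

  -- The grid is finite, so the list of all its points exhausts any difference.
  ⊇⇒≤ᵀ : ∀ {S S′} → points {ν} S′ ⊆ points {ν} S → _≤ᵀ_ ν S S′
  ⊇⇒≤ᵀ {S@(_ , tree)} {S′} S′⊆S =
    contractions (cartesianProduct (upTo (suc (easts ν))) (upTo (suc (norths ν)))) S S′ S′⊆S
      λ p p∈ _ → ∈-cartesianProduct⁺ (∈-upTo⁺ (s≤s (x≤easts tree p∈)))
                                     (∈-upTo⁺ (s≤s (y≤norths tree p∈)))

-- Unions, intersections and order embeddings

infixr 6 _∪_ _∩_

_∪_ _∩_ : {A : Set} → BSet A → BSet A → BSet A
(S ∪ S′) x = S x ∨ S′ x
(S ∩ S′) x = S x ∧ S′ x

module _ {A : Set} (S S′ : BSet A) where

  ∈-∪⁺ : ∀ {x} → x ∈ S ⊎ x ∈ S′ → x ∈ S ∪ S′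
  ∈-∪⁺ {x} = Equivalence.from (T-∨ {S x})

  ∈-∪⁻ : ∀ {x} → x ∈ S ∪ S′ → x ∈ S ⊎ x ∈ S′
  ∈-∪⁻ {x} = Equivalence.to (T-∨ {S x})

  ∈-∩⁺ : ∀ {x} → x ∈ S → x ∈ S′ → x ∈ S ∩ S′
  ∈-∩⁺ {x} p q = Equivalence.from (T-∧ {S x}) (p , q)

  ∈-∩⁻ : ∀ {x} → x ∈ S ∩ S′ → x ∈ S × x ∈ S′
  ∈-∩⁻ {x} = Equivalence.to (T-∧ {S x})

module _ (P Q : Poset 0ℓ 0ℓ 0ℓ) where
  private
    module P = Poset P
    module Q = Poset Q

  -- Congruence and injectivity follow by antisymmetry.
  orderEmbedding : {f : P.Carrier → Q.Carrier} →
                   (∀ {x y} → x P.≤ y → f x Q.≤ f y) → (∀ {x y} → f x Q.≤ f y → x P.≤ y) →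
                   OrderEmbedding P Q f
  orderEmbedding mono cancel = record
    { isOrderHomomorphism = record
      { cong = λ eq → Q.antisym (mono (P.reflexive eq)) (mono (P.reflexive (P.Eq.sym eq)))
      ; mono = mono
      }
    ; injective = λ eq → P.antisym (cancel (Q.reflexive eq)) (cancel (Q.reflexive (Q.Eq.sym eq)))
    ; cancel    = cancel
    }

module _ (P Q : Poset 0ℓ 0ℓ 0ℓ) where
  private
    module P = Poset P
    module Q = Poset Q

  add0̂-isomorphic : (f : P.Carrier → Q.Carrier) →
                    (∀ {x y} → x P.≤ y → f x Q.≤ f y) → (∀ {x y} → f x Q.≤ f y → x P.≤ y) →
                    (∀ y → ∃[ x ] f x Q.≈ y) → Isomorphic (add0̂ P) (add0̂ Q)
  add0̂-isomorphic f mono cancel surj = f₋ , record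
    { isOrderMonomorphism = embedding
    ; surjective          = surj₋
    }
    where
    module P₋ = Poset (add0̂ P)
    module Q₋ = Poset (add0̂ Q)
    f₋ : P₋.Carrier → Q₋.Carrier
    f₋ ⊥₋    = ⊥₋
    f₋ [ x ] = [ f x ]
    mono₋ : ∀ {x y} → x P₋.≤ y → f₋ x Q₋.≤ f₋ y
    mono₋ (⊥₋≤ _) = ⊥₋≤ _
    mono₋ [ x≤y ] = [ mono x≤y ]
    cancel₋ : ∀ {x y} → f₋ x Q₋.≤ f₋ y → x P₋.≤ y
    cancel₋ {⊥₋}              _       = ⊥₋≤ _
    cancel₋ {[ _ ]} {[ _ ]} [ fx≤fy ] = [ cancel fx≤fy ]
    embedding : IsOrderMonomorphism P₋._≈_ Q₋._≈_ P₋._≤_ Q₋._≤_ f₋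
    embedding = orderEmbedding (add0̂ P) (add0̂ Q) mono₋ cancel₋
    surj₋ : ∀ y → ∃[ x ] (∀ {z} → z P₋.≈ x → f₋ z Q₋.≈ y)
    surj₋ ⊥₋    = ⊥₋ , IsOrderMonomorphism.cong embedding
    surj₋ [ y ] = let x , fx≈y = surj y in
      [ x ] , λ z≈x → Q₋.Eq.trans (IsOrderMonomorphism.cong embedding z≈x) [ fx≈y ]

-- Dissections with an empty face form a lattice

module FaceLattice (k : ℕ) where

  _crosses?_ : (d e : Segment k) → Dec (Crosses k d e)
  (i , j) crosses? (i′ , j′) =
    (i Fin.<? i′ ×-dec i′ Fin.<? j ×-dec j Fin.<? j′) ⊎-dec
    (i′ Fin.<? i ×-dec i Fin.<? j′ ×-dec j′ Fin.<? j)

  crosses-sym : ∀ d e → Crosses k d e → Crosses k e d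
  crosses-sym _ _ = [ inj₂ , inj₁ ]′

  -- For dissections, this is the existence of a common refinement.
  CrossFree : Rel (BSet (Segment k)) 0ℓ
  CrossFree D D′ = ∀ d e → d ∈ D → e ∈ D′ → ¬ Crosses k d e

  crossFree? : ∀ D D′ → Dec (CrossFree D D′)
  crossFree? D D′ = map′
    (λ all (i , j) (i′ , j′) → all i j i′ j′)
    (λ all i j i′ j′ → all (i , j) (i′ , j′))
    (Fin.all? λ i → Fin.all? λ j → Fin.all? λ i′ → Fin.all? λ j′ →
      T? (D (i , j)) →-dec T? (D′ (i′ , j′)) →-dec ¬? ((i , j) crosses? (i′ , j′)))

  ∪-dissection : ∀ {D D′} → IsDissection k D → IsDissection k D′ → CrossFree D D′ →
                 IsDissection k (D ∪ D′)
  ∪-dissection {D} {D′} isD isD′ free = record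
    { diagonals   = λ d d∈ → [ D.diagonals d , D′.diagonals d ]′ (∈-∪⁻ D D′ d∈)
    ; nonCrossing = λ d e d∈ e∈ → case (∈-∪⁻ D D′ d∈ , ∈-∪⁻ D D′ e∈) of λ where
        (inj₁ d∈ , inj₁ e∈) → D.nonCrossing d e d∈ e∈
        (inj₁ d∈ , inj₂ e∈) → free d e d∈ e∈
        (inj₂ d∈ , inj₁ e∈) → free e d e∈ d∈ ∘ crosses-sym d e
        (inj₂ d∈ , inj₂ e∈) → D′.nonCrossing d e d∈ e∈
    }
    where
    module D  = IsDissection isD
    module D′ = IsDissection isD′

  ∩-dissection : ∀ {D D′} → IsDissection k D → IsDissection k (D ∩ D′)
  ∩-dissection {D} {D′} isD = record
    { diagonals   = λ d d∈ → diagonals d (proj₁ (∈-∩⁻ D D′ d∈))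
    ; nonCrossing = λ d e d∈ e∈ →
        nonCrossing d e (proj₁ (∈-∩⁻ D D′ d∈)) (proj₁ (∈-∩⁻ D D′ e∈))
    }
    where open IsDissection isD

  ∅ : Dissection k
  ∅ = (λ _ → false) , record { diagonals = λ _ () ; nonCrossing = λ _ _ () }

  private
    L = add0̂ (dissectionPoset k)
    module L = Poset L

  _∧ᴸ_ _∨ᴸ_ : L.Carrier → L.Carrier → L.Carrier
  ⊥₋            ∧ᴸ _               = ⊥₋
  [ _ ]         ∧ᴸ ⊥₋              = ⊥₋
  [ D , isD ]   ∧ᴸ [ D′ , isD′ ]   with crossFree? D D′
  ... | yes free = [ D ∪ D′ , ∪-dissection isD isD′ free ]
  ... | no _     = ⊥₋
  ⊥₋            ∨ᴸ y               = y
  [ D ]         ∨ᴸ ⊥₋              = [ D ]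
  [ D , isD ]   ∨ᴸ [ D′ , isD′ ]   = [ D ∩ D′ , ∩-dissection isD ]

  ∧ᴸ-infimum : Infimum L._≤_ _∧ᴸ_
  ∧ᴸ-infimum ⊥₋    y     = (⊥₋≤ _) , (⊥₋≤ _) , λ _ z≤ _ → z≤
  ∧ᴸ-infimum [ D ] ⊥₋    = (⊥₋≤ _) , (⊥₋≤ _) , λ _ _ z≤ → z≤
  ∧ᴸ-infimum [ D , isD ] [ D′ , isD′ ] with crossFree? D D′
  ... | yes free = [ (λ d → ∈-∪⁺ D D′ ∘ inj₁) ] , [ (λ d → ∈-∪⁺ D D′ ∘ inj₂) ] , λ where
    _ (⊥₋≤ _) _       → ⊥₋≤ _
    _ [ p ]   [ q ]   → [ (λ d → [ p d , q d ]′ ∘ ∈-∪⁻ D D′) ]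
  -- A non-empty lower bound would refine both dissections, so that they could not cross.
  ... | no cross = (⊥₋≤ _) , (⊥₋≤ _) , λ where
    _ (⊥₋≤ _)         _     → ⊥₋≤ _
    [ _ , isC ] [ p ] [ q ] → ⊥-elim (cross λ d e d∈ e∈ →
      IsDissection.nonCrossing isC d e (p d d∈) (q e e∈))

  ∨ᴸ-supremum : Supremum L._≤_ _∨ᴸ_
  ∨ᴸ-supremum ⊥₋    y     = (⊥₋≤ _) , L.refl , λ _ _ ≤z → ≤z
  ∨ᴸ-supremum [ D ] ⊥₋    = L.refl , (⊥₋≤ _) , λ _ ≤z _ → ≤z
  ∨ᴸ-supremum [ D , _ ] [ D′ , _ ] =
    [ (λ d → proj₁ ∘ ∈-∩⁻ D D′) ] , [ (λ d → proj₂ ∘ ∈-∩⁻ D D′) ] , λ where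
      _ [ p ] [ q ] → [ (λ d d∈ → ∈-∩⁺ D D′ (p d d∈) (q d d∈)) ]

  isLatticeᴸ : IsLattice L._≈_ L._≤_ _∨ᴸ_ _∧ᴸ_
  isLatticeᴸ = record
    { isPartialOrder = L.isPartialOrder ; supremum = ∨ᴸ-supremum ; infimum = ∧ᴸ-infimum }

-- From trees to dissections

-- Columns and rows of the grid are placed on the vertices of a k-gon, and the
-- point (x , y) is sent to the segment (col x , row y).  The field common says
-- that points sent to edges carry no information.
record Placement (ν : LatticePath) (k : ℕ) : Set where
  field
    col row   : ℕ → ℕ
    col-mono  : ∀ {x x′} → x < x′ → col x < col x′
    row-mono  : ∀ {y y′} → y < y′ → row y < row y′
    row<k     : ∀ {y} → y ≤ norths ν → row y < k
    region⁻   : ∀ {x y} → Region ν (x , y) → col x < row y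
    region⁺   : ∀ {x y} → x ≤ easts ν → y ≤ norths ν → col x < row y → Region ν (x , y)

  IsDiagonalPoint : Point → Set
  IsDiagonalPoint (x , y) = suc (col x) < row y × ¬ (col x ≡ 0 × suc (row y) ≡ k)

  field
    common    : ∀ {S} → IsSchröderTree ν S → ∀ {p} → Region ν p → ¬ IsDiagonalPoint p → p ∈ S

  -- The bounds make the search for a preimage finite; all points of the region satisfy them.
  Image : BSet Point → Segment k → Set
  Image S (i , j) = ∃[ x ] (x < suc (easts ν) × ∃[ y ] (y < suc (norths ν) ×
                      (col x ≡ toℕ i × row y ≡ toℕ j × (x , y) ∈ S)))

  diagonalPoint? : ∀ p → Dec (IsDiagonalPoint p)
  diagonalPoint? (x , y) = (suc (col x) <? row y) ×-dec ¬? (col x ≟ 0 ×-dec suc (row y) ≟ k)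

  isDiagonal? : ∀ d → Dec (IsDiagonal k d)
  isDiagonal? (i , j) = (suc (toℕ i) <? toℕ j) ×-dec ¬? (toℕ i ≟ 0 ×-dec suc (toℕ j) ≟ k)

  image? : ∀ S d → Dec (Image S d)
  image? S (i , j) = anyUpTo? (λ x → anyUpTo? (λ y →
    (col x ≟ toℕ i) ×-dec (row y ≟ toℕ j) ×-dec T? (S (x , y))) (suc (norths ν))) (suc (easts ν))

  opaque
    dissect : BSet Point → BSet (Segment k)
    dissect S d = ⌊ isDiagonal? d ×-dec image? S d ⌋

    dissect⁻ : ∀ S d → d ∈ dissect S → IsDiagonal k d × Image S d
    dissect⁻ S d = toWitness

    dissect⁺ : ∀ S d → IsDiagonal k d × Image S d → d ∈ dissect S
    dissect⁺ S d = fromWitness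

  segment : ∀ {p} → Region ν p → Segment k
  segment {x , y} r@(_ , y≤ , _) = fromℕ< (<-trans (region⁻ r) (row<k y≤)) , fromℕ< (row<k y≤)

  module _ {x y} (r : Region ν (x , y)) where

    segment₁ : toℕ (proj₁ (segment r)) ≡ col x
    segment₁ = Fin.toℕ-fromℕ< _

    segment₂ : toℕ (proj₂ (segment r)) ≡ row y
    segment₂ = Fin.toℕ-fromℕ< _

    segment∈dissect⁺ : ∀ S → IsDiagonalPoint (x , y) → (x , y) ∈ S → segment r ∈ dissect S
    segment∈dissect⁺ S (gap , ¬edge) p∈S = dissect⁺ S (segment r)
      ( ( subst₂ (λ i j → suc i < j) (sym segment₁) (sym segment₂) gap
        , λ (e₁ , e₂) → ¬edge (trans (sym segment₁) e₁ , trans (cong suc (sym segment₂)) e₂))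
      , x , s≤s (proj₁ r) , y , s≤s (proj₁ (proj₂ r)) , sym segment₁ , sym segment₂ , p∈S)

    segment∈dissect⁻ : ∀ S → segment r ∈ dissect S → (x , y) ∈ S
    segment∈dissect⁻ S s∈ with dissect⁻ S (segment r) s∈
    ... | _ , x′ , _ , y′ , _ , e₁ , e₂ , p∈
      with refl ← strict⇒injective col col-mono (trans e₁ segment₁)
      with refl ← strict⇒injective row row-mono (trans e₂ segment₂) = p∈

  dissect-mono : ∀ {S S′} → S ⊆ S′ → dissect S ⊆ dissect S′
  dissect-mono {S} {S′} S⊆S′ d d∈ with dissect⁻ S d d∈
  ... | diag , x , x< , y , y< , e₁ , e₂ , p∈ =
    dissect⁺ S′ d (diag , x , x< , y , y< , e₁ , e₂ , S⊆S′ _ p∈)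

  -- A point sent to a diagonal is recovered by injectivity of the placement; one sent to an edge
  -- belongs to every tree.
  dissect-cancel : ∀ {S S′} → IsSchröderTree ν S → IsSchröderTree ν S′ →
                   dissect S ⊆ dissect S′ → S ⊆ S′
  dissect-cancel {S} {S′} tree tree′ sub p p∈ with diagonalPoint? p
  ... | yes diag = let r = IsSchröderTree.inRegion tree p p∈ in
                   segment∈dissect⁻ r S′ (sub _ (segment∈dissect⁺ r S diag p∈))
  ... | no ¬diag = common tree′ (IsSchröderTree.inRegion tree p p∈) ¬diag

  dissect-∪ : ∀ {S S′} d → d ∈ dissect (S ∪ S′) → d ∈ dissect S ∪ dissect S′
  dissect-∪ {S} {S′} d d∈ with dissect⁻ (S ∪ S′) d d∈
  ... | diag , x , x< , y , y< , e₁ , e₂ , p∈ = ∈-∪⁺ (dissect S) (dissect S′) (case ∈-∪⁻ S S′ p∈ of λ where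
    (inj₁ p∈) → inj₁ (dissect⁺ S d (diag , x , x< , y , y< , e₁ , e₂ , p∈))
    (inj₂ p∈) → inj₂ (dissect⁺ S′ d (diag , x , x< , y , y< , e₁ , e₂ , p∈)))

  -- By injectivity, the preimages of `d` in `S` and in `S′` coincide.
  dissect-∩ : ∀ {S S′} d → d ∈ dissect S → d ∈ dissect S′ → d ∈ dissect (S ∩ S′)
  dissect-∩ {S} {S′} d d∈ d∈′ with dissect⁻ S d d∈ | dissect⁻ S′ d d∈′
  ... | diag , x , x< , y , y< , e₁ , e₂ , p∈ | _ , x′ , _ , y′ , _ , e₁′ , e₂′ , p∈′
    with refl ← strict⇒injective col col-mono (trans e₁ (sym e₁′))
    with refl ← strict⇒injective row row-mono (trans e₂ (sym e₂′)) =
    dissect⁺ (S ∩ S′) d (diag , x , x< , y , y< , e₁ , e₂ , ∈-∩⁺ S S′ p∈ p∈′)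

  -- The outer inequalities say that the first point is southwest of the second, the middle one that
  -- the southeast corner of their box lies in the region.
  crossing⇒incompatible : ∀ {x₁ y₁ x₂ y₂} → Region ν (x₁ , y₁) → Region ν (x₂ , y₂) →
                          col x₁ < col x₂ → col x₂ < row y₁ → row y₁ < row y₂ →
                          Incompatible ν (x₁ , y₁) (x₂ , y₂)
  crossing⇒incompatible r₁ r₂ l₁ l₂ l₃ = incompatible⁺
    (strict⇒cancel-< col col-mono l₁ , strict⇒cancel-< row row-mono l₃)
    (region⁺ (proj₁ r₂) (proj₁ (proj₂ r₁)) l₂) r₂

  InRegion : BSet Point → Set
  InRegion S = ∀ p → p ∈ S → Region ν p

  dissect-crossFree : ∀ {S S′} → InRegion S → InRegion S′ →
                      (∀ p q → p ∈ S → q ∈ S′ → Compatible ν p q) →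
                      FaceLattice.CrossFree k (dissect S) (dissect S′)
  dissect-crossFree {S} {S′} inR inR′ compat d e d∈ e∈ crosses
    with dissect⁻ S d d∈ | dissect⁻ S′ e e∈
  ... | _ , x , _ , y , _ , e₁ , e₂ , p∈ | _ , x′ , _ , y′ , _ , e₁′ , e₂′ , q∈ =
    compat _ _ p∈ q∈ (case crosses of λ where
      (inj₁ (l₁ , l₂ , l₃)) → crossing⇒incompatible (inR _ p∈) (inR′ _ q∈)
        (subst₂ _<_ (sym e₁) (sym e₁′) l₁)
        (subst₂ _<_ (sym e₁′) (sym e₂) l₂)
        (subst₂ _<_ (sym e₂) (sym e₂′) l₃)
      (inj₂ (l₁ , l₂ , l₃)) → incompatible-sym (crossing⇒incompatible (inR′ _ q∈) (inR _ p∈)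
        (subst₂ _<_ (sym e₁′) (sym e₁) l₁)
        (subst₂ _<_ (sym e₁) (sym e₂′) l₂)
        (subst₂ _<_ (sym e₂′) (sym e₂) l₃)))

  -- The same chain of inequalities in the other direction. Edges cross nothing, so both points are
  -- sent to diagonals.
  incompatible⇒crossing : ∀ {p q} (r : Region ν p) (s : Region ν q) → p ◿ q → Region ν (xOf q , yOf p) →
                          IsDiagonalPoint p × IsDiagonalPoint q × Crosses k (segment r) (segment s)
  incompatible⇒crossing {x , y} {x′ , y′} r s (x< , y<) corner =
    (≤-<-trans i<i′ i′<j , λ (_ , e) → <⇒≱ (row<k (proj₁ (proj₂ s))) (subst (_≤ row y′) e j<j′)) ,
    (≤-<-trans i′<j j<j′ , λ (e , _) → case subst (col x <_) e i<i′ of λ ()) ,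
    inj₁ ( subst₂ _<_ (sym (segment₁ r)) (sym (segment₁ s)) i<i′
         , subst₂ _<_ (sym (segment₁ s)) (sym (segment₂ r)) i′<j
         , subst₂ _<_ (sym (segment₂ r)) (sym (segment₂ s)) j<j′ )
    where
    i<i′ : col x < col x′
    i<i′ = col-mono x<
    i′<j : col x′ < row y
    i′<j = region⁻ corner
    j<j′ : row y < row y′
    j<j′ = row-mono y<

  crossFree⇒compatible : ∀ {S S′} → InRegion S → InRegion S′ →
                         FaceLattice.CrossFree k (dissect S) (dissect S′) →
                         ∀ p q → p ∈ S → q ∈ S′ → Compatible ν p q
  crossFree⇒compatible {S} {S′} inR inR′ free p q p∈ q∈ (inj₁ p◿q , box) =
    let r = inR p p∈ ; s = inR′ q q∈
        diag , diag′ , crosses = incompatible⇒crossing r s p◿q (box _ (southeast-corner p◿q))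
    in free _ _ (segment∈dissect⁺ r S diag p∈) (segment∈dissect⁺ s S′ diag′ q∈) crosses
  crossFree⇒compatible {S} {S′} inR inR′ free p q p∈ q∈ (inj₂ q◿p , box) =
    let r = inR p p∈ ; s = inR′ q q∈
        _ , box′ = incompatible-sym (inj₂ q◿p , box)
        diag′ , diag , crosses = incompatible⇒crossing s r q◿p (box′ _ (southeast-corner q◿p))
    in free _ _ (segment∈dissect⁺ r S diag p∈) (segment∈dissect⁺ s S′ diag′ q∈)
         (FaceLattice.crosses-sym k (segment s) (segment r) crosses)

  treeDissection : SchröderTree ν → Dissection k
  treeDissection (S , tree) = dissect S , record
    { diagonals   = λ d → proj₁ ∘ dissect⁻ S d
    ; nonCrossing = dissect-crossFree inRegion inRegion compatible
    }
    where open IsSchröderTree tree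

  treeDissection-mono : ∀ {S S′} → _≤ᵀ_ ν S S′ → dissect (points {ν} S′) ⊆ dissect (points {ν} S)
  treeDissection-mono {S} {S′} S≤S′ = dissect-mono (≤ᵀ⇒⊇ ν {S} {S′} S≤S′)

  treeDissection-cancel : ∀ {S S′} → dissect (points {ν} S′) ⊆ dissect (points {ν} S) → _≤ᵀ_ ν S S′
  treeDissection-cancel {S} {S′} sub = ⊇⇒≤ᵀ ν {S} {S′} (dissect-cancel (proj₂ S′) (proj₂ S) sub)

-- The lattice of trees and its embedding

module HatEmbedding {ν k} (placement : Placement ν k)
  (inhabited : ∀ {S} → IsSchröderTree ν S → ∃ (_∈ Placement.dissect placement S)) where

  open Placement placement
  open FaceLattice k

  private
    P = treePoset ν
    L = add0̂ (dissectionPoset k)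
    module P̂ = Poset (add0̂1̂ P)
    module L = Poset L
  open IsLattice isLatticeᴸ using (x∧y≤x; x∧y≤y; ∧-greatest)

  -- A decidable form of the row and column conditions, the only ones that the intersection of two
  -- trees can violate.
  Covers : BSet Point → Set
  Covers S = (∀ {y} → y < suc (norths ν) → ∃[ x ] (x < suc (easts ν) × (x , y) ∈ S)) ×
             (∀ {x} → x < suc (easts ν) → ∃[ y ] (y < suc (norths ν) × (x , y) ∈ S))

  covers? : ∀ S → Dec (Covers S)
  covers? S =
    allUpTo? (λ y → anyUpTo? (λ x → T? (S (x , y))) (suc (easts ν))) (suc (norths ν)) ×-dec
    allUpTo? (λ x → anyUpTo? (λ y → T? (S (x , y))) (suc (norths ν))) (suc (easts ν))

  -- Meant for a common upper bound of two trees, which is contained in their intersection.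
  tree-covers : ∀ {S S′} → IsSchröderTree ν S → S ⊆ S′ → Covers S′
  tree-covers tree sub =
    (λ { (s≤s y≤) → let x , p∈ = rows _ y≤ in x , s≤s (x≤easts tree p∈) , sub _ p∈ }) ,
    (λ { (s≤s x≤) → let y , p∈ = columns _ x≤ in y , s≤s (y≤norths tree p∈) , sub _ p∈ })
    where open IsSchröderTree tree

  ∩-tree : ∀ {S S′} → IsSchröderTree ν S → IsSchröderTree ν S′ → Covers (S ∩ S′) →
           IsSchröderTree ν (S ∩ S′)
  ∩-tree {S} {S′} tree tree′ (rows , columns) = record
    { inRegion   = λ p p∈ → T.inRegion p (proj₁ (∈-∩⁻ S S′ p∈))
    ; compatible = λ p q p∈ q∈ → T.compatible p q (proj₁ (∈-∩⁻ S S′ p∈)) (proj₁ (∈-∩⁻ S S′ q∈))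
    ; root       = ∈-∩⁺ S S′ T.root (IsSchröderTree.root tree′)
    ; rows       = λ y y≤ → let x , _ , p∈ = rows (s≤s y≤) in x , p∈
    ; columns    = λ x x≤ → let y , _ , p∈ = columns (s≤s x≤) in y , p∈
    }
    where module T = IsSchröderTree tree

  -- Two incompatible points, one from each tree, would give crossing diagonals.
  ∪-tree : ∀ {S S′} → IsSchröderTree ν S → IsSchröderTree ν S′ →
           CrossFree (dissect S) (dissect S′) → IsSchröderTree ν (S ∪ S′)
  ∪-tree {S} {S′} tree tree′ free = record
    { inRegion   = λ p p∈ → [ T.inRegion p , T′.inRegion p ]′ (∈-∪⁻ S S′ p∈)
    ; compatible = λ p q p∈ q∈ → case (∈-∪⁻ S S′ p∈ , ∈-∪⁻ S S′ q∈) of λ where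
        (inj₁ p∈ , inj₁ q∈) → T.compatible p q p∈ q∈
        (inj₁ p∈ , inj₂ q∈) → mixed p q p∈ q∈
        (inj₂ p∈ , inj₁ q∈) → mixed q p q∈ p∈ ∘ incompatible-sym
        (inj₂ p∈ , inj₂ q∈) → T′.compatible p q p∈ q∈
    ; root       = ∈-∪⁺ S S′ (inj₁ T.root)
    ; rows       = λ y y≤ → let x , p∈ = T.rows y y≤ in x , ∈-∪⁺ S S′ (inj₁ p∈)
    ; columns    = λ x x≤ → let y , p∈ = T.columns x x≤ in y , ∈-∪⁺ S S′ (inj₁ p∈)
    }
    where
    module T  = IsSchröderTree tree
    module T′ = IsSchröderTree tree′
    mixed = crossFree⇒compatible T.inRegion T′.inRegion free

  -- The meet uses the same crossing test as `_∧ᴸ_`, so that both fall to the minimum in the same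
  -- cases.
  _∧ᴾ_ _∨ᴾ_ : P̂.Carrier → P̂.Carrier → P̂.Carrier
  ⊤⁺     ∧ᴾ y      = y
  [ x ]  ∧ᴾ ⊤⁺     = [ x ]
  [ ⊥₋ ] ∧ᴾ [ _ ]  = [ ⊥₋ ]
  [ [ _ ] ] ∧ᴾ [ ⊥₋ ] = [ ⊥₋ ]
  [ [ S , tree ] ] ∧ᴾ [ [ S′ , tree′ ] ] with crossFree? (dissect S) (dissect S′)
  ... | yes free = [ [ S ∪ S′ , ∪-tree tree tree′ free ] ]
  ... | no _     = [ ⊥₋ ]
  ⊤⁺     ∨ᴾ _      = ⊤⁺
  [ _ ]  ∨ᴾ ⊤⁺     = ⊤⁺
  [ ⊥₋ ] ∨ᴾ [ y ]  = [ y ]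
  [ [ S ] ] ∨ᴾ [ ⊥₋ ] = [ [ S ] ]
  [ [ S , tree ] ] ∨ᴾ [ [ S′ , tree′ ] ] with covers? (S ∩ S′)
  ... | yes cov = [ [ S ∩ S′ , ∩-tree tree tree′ cov ] ]
  ... | no _    = ⊤⁺

  ⟦_⟧ : P̂.Carrier → L.Carrier
  ⟦ [ ⊥₋ ] ⟧    = ⊥₋
  ⟦ [ [ S ] ] ⟧ = [ treeDissection S ]
  ⟦ ⊤⁺ ⟧        = [ ∅ ]

  ⟦⟧-mono : ∀ {x y} → x P̂.≤ y → ⟦ x ⟧ L.≤ ⟦ y ⟧
  ⟦⟧-mono [ ⊥₋≤ _ ]                       = ⊥₋≤ _
  ⟦⟧-mono {[ [ S ] ]} {[ [ S′ ] ]} [ [ S≤S′ ] ] = [ treeDissection-mono {S} {S′} S≤S′ ]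
  ⟦⟧-mono ([ ⊥₋ ] ≤⊤⁺)                    = ⊥₋≤ _
  ⟦⟧-mono ([ [ _ ] ] ≤⊤⁺)                 = [ (λ _ ()) ]
  ⟦⟧-mono (⊤⁺ ≤⊤⁺)                        = L.refl

  ⟦⟧-cancel : ∀ {x y} → ⟦ x ⟧ L.≤ ⟦ y ⟧ → x P̂.≤ y
  ⟦⟧-cancel {_}         {⊤⁺}      _     = _ ≤⊤⁺
  ⟦⟧-cancel {[ ⊥₋ ]}    {[ _ ]}   _     = [ ⊥₋≤ _ ]
  ⟦⟧-cancel {[ [ S ] ]} {[ [ S′ ] ]} [ sub ] = [ [ treeDissection-cancel {S} {S′} sub ] ]
  -- The maximum goes to the empty dissection, and `inhabited` keeps the trees away from it.
  ⟦⟧-cancel {⊤⁺} {[ [ S , tree ] ]} [ sub ] = let d , d∈ = inhabited tree in ⊥-elim (sub d d∈)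

  ∧-homo : ∀ x y → ⟦ x ∧ᴾ y ⟧ L.≈ ⟦ x ⟧ ∧ᴸ ⟦ y ⟧
  ∧-homo ⊤⁺ y = L.antisym (∧-greatest (⟦⟧-mono (y ≤⊤⁺)) L.refl) (x∧y≤y ⟦ ⊤⁺ ⟧ ⟦ y ⟧)
  ∧-homo [ x ] ⊤⁺ = L.antisym (∧-greatest L.refl (⟦⟧-mono ([ x ] ≤⊤⁺))) (x∧y≤x ⟦ [ x ] ⟧ ⟦ ⊤⁺ ⟧)
  ∧-homo [ ⊥₋ ] [ _ ] = ∙≈∙
  ∧-homo [ [ S ] ] [ ⊥₋ ] = ∙≈∙
  ∧-homo [ [ S , tree ] ] [ [ S′ , tree′ ] ] with crossFree? (dissect S) (dissect S′)
  ... | yes free = [ ⊆-antisym dissect-∪ (λ d →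
    [ dissect-mono (λ p → ∈-∪⁺ S S′ ∘ inj₁) d , dissect-mono (λ p → ∈-∪⁺ S S′ ∘ inj₂) d ]′ ∘
    ∈-∪⁻ (dissect S) (dissect S′)) ]
  ... | no _     = ∙≈∙

  -- In the excluded case the join in `L` of two trees is still the intersection of their
  -- dissections, which need not be empty.
  ∨-homo : ∀ x y → ¬ (x ∨ᴾ y P̂.≈ ⊤⁺) → ⟦ x ∨ᴾ y ⟧ L.≈ ⟦ x ⟧ ∨ᴸ ⟦ y ⟧
  ∨-homo ⊤⁺ y ≉⊤ = ⊥-elim (≉⊤ ∙≈∙)
  ∨-homo [ x ] ⊤⁺ ≉⊤ = ⊥-elim (≉⊤ ∙≈∙)
  ∨-homo [ ⊥₋ ] [ y ] _ = L.Eq.refl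
  ∨-homo [ [ S ] ] [ ⊥₋ ] _ = L.Eq.refl
  ∨-homo [ [ S , tree ] ] [ [ S′ , tree′ ] ] ≉⊤ with covers? (S ∩ S′)
  ... | no _  = ⊥-elim (≉⊤ ∙≈∙)
  ... | yes _ = [ ⊆-antisym
    (λ d d∈ → ∈-∩⁺ (dissect S) (dissect S′)
      (dissect-mono (λ p → proj₁ ∘ ∈-∩⁻ S S′) d d∈) (dissect-mono (λ p → proj₂ ∘ ∈-∩⁻ S S′) d d∈))
    (λ d d∈ → let d∈S , d∈S′ = ∈-∩⁻ (dissect S) (dissect S′) d∈ in dissect-∩ d d∈S d∈S′) ]

  -- Meets map to meets and ⟦_⟧ reflects the order, so they are infima.
  ∧ᴾ-infimum : Infimum P̂._≤_ _∧ᴾ_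
  ∧ᴾ-infimum x y =
    ⟦⟧-cancel (L.trans (L.reflexive (∧-homo x y)) (x∧y≤x ⟦ x ⟧ ⟦ y ⟧)) ,
    ⟦⟧-cancel (L.trans (L.reflexive (∧-homo x y)) (x∧y≤y ⟦ x ⟧ ⟦ y ⟧)) ,
    λ z z≤x z≤y → ⟦⟧-cancel (L.trans (∧-greatest (⟦⟧-mono z≤x) (⟦⟧-mono z≤y))
                                     (L.reflexive (L.Eq.sym (∧-homo x y))))

  ∨ᴾ-supremum : Supremum P̂._≤_ _∨ᴾ_
  ∨ᴾ-supremum ⊤⁺ y = P̂.refl , (y ≤⊤⁺) , λ _ ≤z _ → ≤z
  ∨ᴾ-supremum [ x ] ⊤⁺ = ([ x ] ≤⊤⁺) , P̂.refl , λ _ _ ≤z → ≤z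
  ∨ᴾ-supremum [ ⊥₋ ] [ y ] = [ ⊥₋≤ _ ] , P̂.refl , λ _ _ ≤z → ≤z
  ∨ᴾ-supremum [ [ S ] ] [ ⊥₋ ] = P̂.refl , [ ⊥₋≤ _ ] , λ _ ≤z _ → ≤z
  ∨ᴾ-supremum [ [ T@(S , tree) ] ] [ [ T′@(S′ , tree′) ] ] with covers? (S ∩ S′)
  ... | yes cov = [ [ ⊇⇒≤ᵀ ν {T} {T∩T′} (λ p → proj₁ ∘ ∈-∩⁻ S S′) ] ] ,
                  [ [ ⊇⇒≤ᵀ ν {T′} {T∩T′} (λ p → proj₂ ∘ ∈-∩⁻ S S′) ] ] , λ where
      _ (_ ≤⊤⁺) _ → _ ≤⊤⁺
      [ [ U ] ] [ [ T≤U ] ] [ [ T′≤U ] ] → [ [ ⊇⇒≤ᵀ ν {T∩T′} {U} (λ p p∈ →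
        ∈-∩⁺ S S′ (≤ᵀ⇒⊇ ν {T} {U} T≤U p p∈) (≤ᵀ⇒⊇ ν {T′} {U} T′≤U p p∈)) ] ]
    where T∩T′ = S ∩ S′ , ∩-tree tree tree′ cov
  -- A tree above both would lie inside the intersection, which misses a row or a column.
  ... | no ¬cov = (_ ≤⊤⁺) , (_ ≤⊤⁺) , λ where
      _ (_ ≤⊤⁺) _ → _ ≤⊤⁺
      [ [ U ] ] [ [ T≤U ] ] [ [ T′≤U ] ] → ⊥-elim (¬cov (tree-covers (proj₂ U) (λ p p∈ →
        ∈-∩⁺ S S′ (≤ᵀ⇒⊇ ν {T} {U} T≤U p p∈) (≤ᵀ⇒⊇ ν {T′} {U} T′≤U p p∈))))

  hatSublattice : HatSublattice P L
  hatSublattice = record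
    { isLattice   = record
        { isPartialOrder = P̂.isPartialOrder ; supremum = ∨ᴾ-supremum ; infimum = ∧ᴾ-infimum }
    ; isLatticeᴸ  = isLatticeᴸ
    ; isEmbedding = orderEmbedding (add0̂1̂ P) L ⟦⟧-mono ⟦⟧-cancel
    ; ∧-homo      = ∧-homo
    ; ∨-homo      = ∨-homo
    }

-- The placement for a general path

module _ (ν : LatticePath) where

  lastRow : suc (rowVertex ν (norths ν)) ≡ length ν + 3
  lastRow = trans (cong suc (rowVertex-norths ν)) (+-comm 3 (length ν))

  -- Edges between consecutive vertices are ruled out by the gap. The remaining edge joins vertex 0
  -- to the last vertex, and by injectivity only the root is sent there.
  nonRoot⇒diagonal : ∀ {x y} → Region ν (x , y) → (x , y) ≢ (0 , norths ν) →
                     suc (colVertex ν x) < rowVertex ν y ×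
                     ¬ (colVertex ν x ≡ 0 × suc (rowVertex ν y) ≡ length ν + 3)
  nonRoot⇒diagonal r ≢root = region⇒col<row ν r , λ (e₁ , e₂) → ≢root (cong₂ _,_
    (strict⇒injective (colVertex ν) (colVertex-mono ν) e₁)
    (strict⇒injective (rowVertex ν) (rowVertex-mono ν) (suc-injective (trans e₂ (sym lastRow)))))

  pathPlacement : Placement ν (length ν + 3)
  pathPlacement = record
    { col      = colVertex ν
    ; row      = rowVertex ν
    ; col-mono = colVertex-mono ν
    ; row-mono = rowVertex-mono ν
    ; row<k    = λ y≤ → ≤-trans (s≤s (strict⇒weak (rowVertex ν) (rowVertex-mono ν) y≤))
                                (≤-reflexive lastRow)
    ; region⁻  = λ r → <⇒≤ (region⇒col<row ν r)
    ; region⁺  = col<row⇒region ν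
    ; common   = common
    }
    where
    common : ∀ {S} → IsSchröderTree ν S → ∀ {p} → Region ν p → ¬ _ → p ∈ S
    common tree {p} r ¬diag with ≡-dec _≟_ _≟_ p (0 , norths ν)
    ... | yes refl  = IsSchröderTree.root tree
    ... | no  ≢root = ⊥-elim (¬diag (nonRoot⇒diagonal r ≢root))

  open Placement pathPlacement

  -- A first step `N` puts row 0 below the root, and a first step `E` puts the last column to its
  -- right; either contains a second point of the tree.
  dissect-inhabited : ν ≢ [] → ∀ {S} → IsSchröderTree ν S → ∃ (_∈ dissect S)
  dissect-inhabited ν≢[] {S} tree =
    let p , p∈ , p≢root = nonRoot ν ν≢[] tree
        r = IsSchröderTree.inRegion tree p p∈
    in segment r , segment∈dissect⁺ r S (nonRoot⇒diagonal r p≢root) p∈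
    where
    nonRoot : ∀ ν → ν ≢ [] → ∀ {S} → IsSchröderTree ν S → ∃[ p ] (p ∈ S × p ≢ (0 , norths ν))
    nonRoot []      ν≢[] _    = ⊥-elim (ν≢[] refl)
    nonRoot (N ∷ ν) _    tree = let x , p∈ = IsSchröderTree.rows tree 0 z≤n in
                                _ , p∈ , λ ()
    nonRoot (E ∷ ν) _    tree = let y , p∈ = IsSchröderTree.columns tree (suc (easts ν)) ≤-refl in
                                _ , p∈ , λ ()

-- The staircase path and the associahedron

norths-[NE]^ : ∀ k → norths ([NE]^ k) ≡ k
norths-[NE]^ zero    = refl
norths-[NE]^ (suc k) = cong suc (norths-[NE]^ k)

easts-[NE]^ : ∀ k → easts ([NE]^ k) ≡ k
easts-[NE]^ zero    = refl
easts-[NE]^ (suc k) = cong suc (easts-[NE]^ k)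

region-[NE]^⁻ : ∀ k {x y} → Region ([NE]^ k) (x , y) → x ≤ y
region-[NE]^⁻ k       {zero}          _ = z≤n
region-[NE]^⁻ zero    {suc x}         (() , _)
region-[NE]^⁻ (suc k) {suc x} {zero}  r = ⊥-elim (region-N-zero r)
region-[NE]^⁻ (suc k) {suc x} {suc y} r = s≤s (region-[NE]^⁻ k (region-E⁻ (region-N⁻ r)))

region-[NE]^⁺ : ∀ k {x y} → y ≤ k → x ≤ y → Region ([NE]^ k) (x , y)
region-[NE]^⁺ k       {y = y} y≤k z≤n = region-zero _ (subst (y ≤_) (sym (norths-[NE]^ k)) y≤k)
region-[NE]^⁺ (suc k) (s≤s y≤k) (s≤s x≤y) = region-N⁺ (region-E⁺ (region-[NE]^⁺ k y≤k x≤y))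

≤norths⁻ : ∀ k {y} → y ≤ norths ([NE]^ k) → y ≤ k
≤norths⁻ k {y} = subst (y ≤_) (norths-[NE]^ k)

≤easts⁻ : ∀ k {x} → x ≤ easts ([NE]^ k) → x ≤ k
≤easts⁻ k {x} = subst (x ≤_) (easts-[NE]^ k)

-- Row x contains a point (x₁ , x) with x₁ ≤ x and column x a point (x , y₂) with
-- x ≤ y₂; unless one of them is (x , x), they are incompatible.
main-diagonal∈tree : ∀ {k S} → IsSchröderTree ([NE]^ k) S → ∀ x → x ≤ k → (x , x) ∈ S
main-diagonal∈tree {k} {S} tree x x≤k
  with rows x (subst (x ≤_) (sym (norths-[NE]^ k)) x≤k)
     | columns x (subst (x ≤_) (sym (easts-[NE]^ k)) x≤k)
  where open IsSchröderTree tree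
... | x₁ , p∈ | y₂ , q∈
  with m≤n⇒m<n∨m≡n (region-[NE]^⁻ k (inRegion _ p∈)) | m≤n⇒m<n∨m≡n (region-[NE]^⁻ k (inRegion _ q∈))
  where open IsSchröderTree tree
... | inj₂ refl | _         = p∈
... | _         | inj₂ refl = q∈
... | inj₁ x₁<x | inj₁ x<y₂ = ⊥-elim (compatible _ _ p∈ q∈
  (incompatible⁺ (x₁<x , x<y₂) (region-[NE]^⁺ k x≤k ≤-refl) (inRegion _ q∈)))
  where open IsSchröderTree tree

module Associahedron (n : ℕ) where

  private
    ν = [NE]^ (suc n)

  -- Columns and rows share vertices here: the columns take 0 to n + 1 and the rows 1 to n + 2, so n
  -- + 3 vertices suffice instead of the 2n + 5 of `pathPlacement`.
  placement : Placement ν (n + 3)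
  placement = record
    { col      = id
    ; row      = suc
    ; col-mono = id
    ; row-mono = s<s
    ; row<k    = λ y≤ → ≤-trans (s≤s (s≤s (≤norths⁻ (suc n) y≤))) (≤-reflexive (+-comm 3 n))
    ; region⁻  = s≤s ∘ region-[NE]^⁻ (suc n)
    ; region⁺  = λ _ y≤ x<1+y →
        region-[NE]^⁺ (suc n) (≤norths⁻ (suc n) y≤) (s≤s⁻¹ x<1+y)
    ; common   = common
    }
    where
    common : ∀ {S} → IsSchröderTree ν S → ∀ {p} → Region ν p → ¬ _ → p ∈ S
    common {S} tree {x , y} r@(_ , y≤ , _) ¬diag
      with m≤n⇒m<n∨m≡n (region-[NE]^⁻ (suc n) r) | x ≟ 0 ×-dec suc (suc y) ≟ n + 3
    ... | inj₂ refl | _ = main-diagonal∈tree tree x (≤norths⁻ (suc n) y≤)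
    ... | inj₁ x<y  | no ¬edge = ⊥-elim (¬diag (s<s x<y , ¬edge))
    ... | inj₁ x<y  | yes (refl , e) = subst (λ z → (0 , z) ∈ S) norths≡y (IsSchröderTree.root tree)
      where
      norths≡y : norths ν ≡ y
      norths≡y = trans (norths-[NE]^ (suc n)) (suc-injective (suc-injective (sym (trans e (+-comm n 3)))))

  open Placement placement

  -- The inverse of `dissect`: the preimages of the diagonals in `D`, together with the points sent
  -- to edges, namely the main diagonal and the root.
  FromDissection : BSet (Segment (n + 3)) → Point → Set
  FromDissection D (x , y) =
    y ≤ suc n ×
    (x ≡ y ⊎ (x ≡ 0 × y ≡ suc n) ⊎ ∃[ i ] ∃[ j ] (toℕ i ≡ x × toℕ j ≡ suc y × (i , j) ∈ D))

  fromDissection? : ∀ D p → Dec (FromDissection D p)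
  fromDissection? D (x , y) =
    (y ≤? suc n) ×-dec ((x ≟ y) ⊎-dec ((x ≟ 0) ×-dec (y ≟ suc n)) ⊎-dec
    (Fin.any? λ i → Fin.any? λ j → (toℕ i ≟ x) ×-dec (toℕ j ≟ suc y) ×-dec T? (D (i , j))))

  fromDissection : BSet (Segment (n + 3)) → BSet Point
  fromDissection D p = ⌊ fromDissection? D p ⌋

  module _ {D} (isDissection : IsDissection (n + 3) D) where
    open IsDissection isDissection

    fromDissection-ordered : ∀ {x y} → FromDissection D (x , y) → x ≤ y
    fromDissection-ordered (_ , inj₁ refl)              = ≤-refl
    fromDissection-ordered (_ , inj₂ (inj₁ (refl , _))) = z≤n
    fromDissection-ordered (_ , inj₂ (inj₂ (i , j , refl , e , d∈))) =
      <⇒≤ (s<s⁻¹ (subst (suc (toℕ i) <_) e (proj₁ (diagonals _ d∈))))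

    -- A point of the main diagonal contradicts `xOf q ≤ yOf p`, nothing in the grid is strictly
    -- southwest or northeast of the root, and two points coming from `D` would give crossing
    -- diagonals.
    fromDissection-compatible : ∀ {p q} → FromDissection D p → FromDissection D q →
                                p ◿ q → ¬ Region ν (xOf q , yOf p)
    fromDissection-compatible p∈ q∈ (x< , y<) corner with region-[NE]^⁻ (suc n) corner
    fromDissection-compatible (_ , inj₁ refl) q∈ (x< , y<) _ | xq≤yp = <⇒≱ x< xq≤yp
    fromDissection-compatible (_ , inj₂ (inj₁ (_ , refl))) (yq≤ , _) (_ , y<) _ | _ = <⇒≱ y< yq≤
    fromDissection-compatible (_ , inj₂ (inj₂ _)) (_ , inj₁ refl) (_ , y<) _ | xq≤yp = <⇒≱ y< xq≤yp
    fromDissection-compatible (_ , inj₂ (inj₂ _)) (_ , inj₂ (inj₁ (refl , _))) (() , _) _ | _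
    fromDissection-compatible (_ , inj₂ (inj₂ (i , j , refl , e , d∈)))
                              (_ , inj₂ (inj₂ (i′ , j′ , refl , e′ , d∈′))) (x< , y<) _ | xq≤yp =
      nonCrossing _ _ d∈ d∈′ (inj₁ ( x< , subst (toℕ i′ <_) (sym e) (s≤s xq≤yp)
                                   , subst₂ _<_ (sym e) (sym e′) (s<s y<) ))

    fromDissection-tree : IsSchröderTree ν (fromDissection D)
    fromDissection-tree = record
      { inRegion   = λ p p∈ → let m = toWitness p∈ in
                     region-[NE]^⁺ (suc n) (proj₁ m) (fromDissection-ordered m)
      ; compatible = λ where
          p q p∈ q∈ (inj₁ p◿q , box) →
            fromDissection-compatible (toWitness p∈) (toWitness q∈) p◿q (box _ (southeast-corner p◿q))
          p q p∈ q∈ (inj₂ q◿p , box) →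
            fromDissection-compatible (toWitness q∈) (toWitness p∈) q◿p
              (proj₂ (incompatible-sym (inj₂ q◿p , box)) _ (southeast-corner q◿p))
      ; root       = fromWitness
          (≤-reflexive (norths-[NE]^ (suc n)) , inj₂ (inj₁ (refl , norths-[NE]^ (suc n))))
      ; rows       = λ y y≤ → y , fromWitness (≤norths⁻ (suc n) y≤ , inj₁ refl)
      ; columns    = λ x x≤ → x , fromWitness (≤easts⁻ (suc n) x≤ , inj₁ refl)
      }

    dissect-fromDissection : dissect (fromDissection D) ≗ D
    dissect-fromDissection = ⊆-antisym to from
      where
      to : dissect (fromDissection D) ⊆ D
      to (i , j) d∈ with dissect⁻ (fromDissection D) (i , j) d∈
      ... | (gap , ¬edge) , x , _ , y , _ , refl , e , p∈ with toWitness {a? = fromDissection? D (x , y)} p∈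
      -- The points added to those from `D` are sent to edges, so they cannot account for a
      -- diagonal.
      ... | _ , inj₁ refl = ⊥-elim (<-irrefl e gap)
      ... | _ , inj₂ (inj₁ (x≡0 , refl)) = ⊥-elim (¬edge (x≡0 , trans (cong suc (sym e)) (+-comm 3 n)))
      ... | _ , inj₂ (inj₂ (i′ , j′ , e₁ , e₂ , d∈D))
        with refl ← Fin.toℕ-injective e₁ with refl ← Fin.toℕ-injective (trans e₂ e) = d∈D
      from : D ⊆ dissect (fromDissection D)
      from (i , j) d∈ = dissect⁺ (fromDissection D) (i , j)
        ( diagonals _ d∈
        , toℕ i , s≤s (subst (toℕ i ≤_) (sym (easts-[NE]^ (suc n))) (≤-trans i≤y y≤))
        , y     , s≤s (subst (y ≤_) (sym (norths-[NE]^ (suc n))) y≤)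
        , refl , sym j≡1+y
        , fromWitness (y≤ , inj₂ (inj₂ (i , j , refl , j≡1+y , d∈))) )
        where
        y : ℕ
        -- Row `y` sits on vertex `y + 1`; as `j` exceeds `i + 1`, it is not 0.
        y = pred (toℕ j)
        gap : suc (toℕ i) < toℕ j
        gap = proj₁ (diagonals _ d∈)
        j≡1+y : toℕ j ≡ suc y
        j≡1+y = sym (suc-pred (toℕ j) ⦃ >-nonZero (<-trans z<s gap) ⦄)
        i≤y : toℕ i ≤ y
        i≤y = <⇒≤ (s<s⁻¹ (subst (suc (toℕ i) <_) j≡1+y gap))
        y≤ : y ≤ suc n
        y≤ = s≤s⁻¹ (s≤s⁻¹ (subst₂ _<_ j≡1+y (+-comm n 3) (Fin.toℕ<n j)))

  isomorphism : Isomorphic (add0̂ (treePoset ν)) (faceLattice n)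
  isomorphism = add0̂-isomorphic (treePoset ν) (dissectionPoset (n + 3)) treeDissection
    (λ {S} {S′} → treeDissection-mono {S} {S′}) (λ {S} {S′} → treeDissection-cancel {S} {S′})
    λ (D , isD) → (fromDissection D , fromDissection-tree isD) , dissect-fromDissection isD

corollary4p10 : (∀ (n : ℕ) → Isomorphic (add0̂ (treePoset ([NE]^ (suc n)))) (faceLattice n))
    ×
    (∀ (ν : LatticePath) → ν ≢ [] →
    HatSublattice (treePoset ν) (faceLattice (length ν)))
corollary4p10 =
  Associahedron.isomorphism ,
  λ ν ν≢[] → HatEmbedding.hatSublattice (pathPlacement ν) (dissect-inhabited ν ν≢[])
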